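{- For every $n\ge 3$, the inversion sequence $\sigma=(0,1,2,\ldots,n-3,0,1)\in I_n$ (that is, $\sigma_i=i-1$ for $1\le i\le n-2$, $\sigma_{n-1}=0$, $\sigma_n=1$) satisfies $\Theta^{n-3}(\sigma)\ne\Theta^{n-2}(\sigma)$. Consequently, the bound of $n-2$ iterations in the statement "for every $\sigma\in I_n$, the sequence $\Theta^{n-2}(\sigma)$ is fixed by $\Theta$" is sharp.
   Context: $I_n$ is the set of inversion sequences of length $n$, i.e. integer sequences $\sigma=(\sigma_1,\ldots,\sigma_n)$ with $0\le\sigma_i<i$ for every $1\le i\le n$. For a finite integer sequence $\sigma$ of length $n$, $\Theta(\sigma)$ is the sequence of length $n$ defined by $\Theta(\sigma)_i=\#\{j<i:\sigma_j<\sigma_i\}$. $\Theta^k$ denotes the $k$-fold iterate of $\Theta$, with $\Theta^0$ the identity. A sequence $\tau$ is fixed by $\Theta$ if $\Theta(\tau)=\tau$. Sharpness means that $n-2$ cannot be replaced by $n-3$: not every $\sigma\in I_n$ has $\Theta^{n-3}(\sigma)$ fixed by $\Theta$. -}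

module Defs where

open import Data.Bool.Base using (if_then_else_)
open import Data.Fin.Base as Fin using (Fin; toℕ)
import Data.Fin.Properties as Fin
open import Data.Integer.Base using (ℤ; +_; 0ℤ; 1ℤ; _≤_; _<_)
open import Data.Integer.Properties using (_<?_)
open import Data.Nat.Base using (ℕ; suc; _∸_; _≤ᵇ_; _≡ᵇ_)
open import Data.Nat.GeneralisedArithmetic using (iterate)
open import Data.Product.Base using (_×_)
open import Data.Vec.Base using (Vec; lookup; tabulate; count; allFin)
open import Relation.Binary.PropositionalEquality.Core using (_≡_)
open import Relation.Nullary.Decidable using (_×-dec_)

-- Sequences are indexed 1, …, n; `pos i` is the 1-based index of i.
pos : ∀ {n} → Fin n → ℕ
pos i = suc (toℕ i)

IsInversionSequence : ∀ {n} → Vec ℤ n → Set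
IsInversionSequence {n} σ = (i : Fin n) → 0ℤ ≤ lookup σ i × lookup σ i < + pos i

Θ : ∀ {n} → Vec ℤ n → Vec ℤ n
Θ {n} σ = tabulate λ i →
  + count (λ j → (j Fin.<? i) ×-dec (lookup σ j <? lookup σ i)) (allFin n)

Θ^ : ∀ {n} → ℕ → Vec ℤ n → Vec ℤ n
Θ^ k σ = iterate Θ σ k

FixedByΘ : ∀ {n} → Vec ℤ n → Set
FixedByΘ τ = Θ τ ≡ τ

-- The sequence (0, 1, …, n-3, 0, 1); only meaningful for n ≥ 2, because of
-- the truncated subtractions.
extremal : (n : ℕ) → Vec ℤ n
extremal n = tabulate λ i →
  if pos i ≤ᵇ n ∸ 2 then + (pos i ∸ 1)
  else if pos i ≡ᵇ n ∸ 1 then 0ℤ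
  else 1ℤ

{-# OPTIONS --safe #-}

-- Write τ_a = (0, 1, …, n-3, 0, a), so that the given sequence is τ_1. For
-- 1 ≤ a ≤ n-2 the entries below a that precede the last one are 0, …, a-1 and
-- the penultimate 0, whence Θ(τ_a) = τ_{a+1}. Thus Θ^k(τ_1) = τ_{k+1} for
-- k ≤ n-2, and the last entry still changes in step n-2.
module Submission where

open import Defs
open import Data.Bool.Base using (if_then_else_)
open import Data.Fin.Base as Fin using (Fin; toℕ; fromℕ)
open import Data.Fin.Properties as Fin using (toℕ<n; toℕ-fromℕ)
open import Data.Integer.Base using (ℤ; +_; 0ℤ; +<+; +≤+) renaming (_≤_ to _≤ℤ_; _<_ to _<ℤ_)
open import Data.Integer.Properties using (+-injective; drop‿+<+) renaming (_<?_ to _<ℤ?_)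
open import Data.Nat.Base using (ℕ; zero; suc; _+_; _≤_; _<_; _∸_; _<ᵇ_; _≡ᵇ_; z≤n; s≤s; z<s; s<s; s<s⁻¹; s≤s⁻¹)
open import Data.Nat.Properties using
  ( _<?_; _≟_; n≮0; n<1⇒n≡0; suc-injective; m≤n⇒m<n∨m≡n; n≮n; m+n≮n; 1+n≢n; ≤-refl; ≤-trans
  ; ≤-reflexive; <⇒≤; <-trans; <-≤-trans; m<n⇒m<1+n; m≤n⇒m≤1+n; m≤n⇒m≤o+n; m+n≤o⇒n≤o; m≤n+m
  ; +-suc; +-comm )
open import Data.Product.Base using (_×_; _,_; proj₁)
open import Data.Sum.Base as Sum using (_⊎_; inj₁; inj₂)
open import Data.Vec.Base using (Vec; lookup; allFin; tabulate; count)
open import Data.Vec.Properties using (lookup∘tabulate; tabulate-cong)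
open import Function.Base using (_∘_; id)
open import Function.Bundles using (_⇔_; mk⇔; Equivalence)
open import Function.Construct.Identity using (⇔-id)
open import Function.Construct.Composition using (_⇔-∘_)
open import Relation.Binary.PropositionalEquality using (_≡_; _≢_; refl; sym; trans; cong; subst; module ≡-Reasoning)
open import Relation.Nullary using (¬_; contradiction)
open import Relation.Nullary.Decidable using (_×-dec_; dec-true; dec-false)
open import Relation.Unary using (Pred; Decidable)

open Equivalence using (to; from)

module _ {ℓ p} {A : Set ℓ} {P : Pred A p} (P? : Decidable P) where

  -- An arbitrary `f` lets the induction pass to `f ∘ Fin.suc`; the case needed later is `f = id`,
  -- since `allFin` is `tabulate id`.
  count-tabulate-< : ∀ {n} (f : Fin n → A) {a} → a ≤ n →
    (∀ i → P (f i) ⇔ toℕ i < a) → count P? (tabulate f) ≡ a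
  count-tabulate-< {zero} f z≤n P⇔ = refl
  count-tabulate-< {suc n} f {zero} a≤n P⇔
    rewrite dec-false (P? (f Fin.zero)) (n≮0 ∘ to (P⇔ Fin.zero))
    = count-tabulate-< (f ∘ Fin.suc) z≤n λ i →
        mk⇔ (λ q → contradiction (to (P⇔ (Fin.suc i)) q) n≮0) (λ ())
  count-tabulate-< {suc n} f {suc a} a≤n P⇔
    rewrite dec-true (P? (f Fin.zero)) (from (P⇔ Fin.zero) z<s)
    = cong suc (count-tabulate-< (f ∘ Fin.suc) (s≤s⁻¹ a≤n) λ i →
        mk⇔ s<s⁻¹ s<s ⇔-∘ P⇔ (Fin.suc i))

  -- As a ≤ b, the index b is not among the first a and adds one to the count. The induction lowers
  -- a and b together, then b alone; at a = b = 0 the only index is 0, which is the segment below 1.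
  count-tabulate-<⊎≡ : ∀ {n} (f : Fin n → A) {a b} → a ≤ b → b < n →
    (∀ i → P (f i) ⇔ (toℕ i < a ⊎ toℕ i ≡ b)) → count P? (tabulate f) ≡ suc a
  count-tabulate-<⊎≡ {suc n} f {zero} {zero} _ _ P⇔ =
    count-tabulate-< f (s≤s z≤n) λ i →
      mk⇔ (λ { (inj₁ ()) ; (inj₂ i≡0) → subst (_< 1) (sym i≡0) z<s })
          (inj₂ ∘ n<1⇒n≡0)
      ⇔-∘ P⇔ i
  count-tabulate-<⊎≡ {suc n} f {zero} {suc b} _ b<n P⇔
    rewrite dec-false (P? (f Fin.zero)) ((λ { (inj₁ ()) ; (inj₂ ()) }) ∘ to (P⇔ Fin.zero))
    = count-tabulate-<⊎≡ (f ∘ Fin.suc) z≤n (s<s⁻¹ b<n) λ i →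
        mk⇔ (Sum.map (λ ()) suc-injective) (Sum.map (λ ()) (cong suc))
        ⇔-∘ P⇔ (Fin.suc i)
  count-tabulate-<⊎≡ {suc n} f {suc a} {suc b} a≤b b<n P⇔
    rewrite dec-true (P? (f Fin.zero)) (from (P⇔ Fin.zero) (inj₁ z<s))
    = cong suc (count-tabulate-<⊎≡ (f ∘ Fin.suc) (s≤s⁻¹ a≤b) (s<s⁻¹ b<n) λ i →
        mk⇔ (Sum.map s<s⁻¹ suc-injective) (Sum.map s<s (cong suc))
        ⇔-∘ P⇔ (Fin.suc i))

-- 0-based entries of τ_a, with N = n-2. The shape of the conditional makes
-- extremal (2 + N) ≡ τ N 1 hold definitionally.
entry : ℕ → ℕ → ℕ → ℤ
entry N a k = if k <ᵇ N then + k else if k ≡ᵇ N then 0ℤ else + a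

τ : (N a : ℕ) → Vec ℤ (2 + N)
τ N a = tabulate (entry N a ∘ toℕ)

-- Indexed by the position itself, so that matching turns k into N or N + 1 and the matching `entry`
-- equation can be used for rewriting.
data Position (N : ℕ) : ℕ → Set where
  initial     : ∀ {k} → k < N → Position N k
  penultimate : Position N N
  last        : Position N (suc N)

position : ∀ {N k} → k < 2 + N → Position N k
position {N} {k} k<2+N with m≤n⇒m<n∨m≡n (s≤s⁻¹ k<2+N)
... | inj₂ refl = last
... | inj₁ k<1+N with m≤n⇒m<n∨m≡n (s≤s⁻¹ k<1+N)
...   | inj₂ refl = penultimate
...   | inj₁ k<N  = initial k<N

module _ (N a : ℕ) where

  entry-initial : ∀ {k} → k < N → entry N a k ≡ + k
  entry-initial {k} k<N rewrite dec-true (k <? N) k<N = refl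

  entry-penultimate : entry N a N ≡ 0ℤ
  entry-penultimate
    rewrite dec-false (N <? N) (n≮n N) | dec-true (N ≟ N) refl = refl

  entry-last : entry N a (suc N) ≡ + a
  entry-last
    rewrite dec-false (suc N <? N) (m+n≮n 1 N) | dec-false (suc N ≟ N) 1+n≢n = refl

  entry≥0 : ∀ {k} → Position N k → 0ℤ ≤ℤ entry N a k
  entry≥0 (initial k<N) rewrite entry-initial k<N = +≤+ z≤n
  entry≥0 penultimate   rewrite entry-penultimate = +≤+ z≤n
  entry≥0 last          rewrite entry-last        = +≤+ z≤n

  entry< : a < 2 + N → ∀ {k} → Position N k → entry N a k <ℤ + suc k
  entry< _     (initial k<N) rewrite entry-initial k<N = +<+ ≤-refl
  entry< _     penultimate   rewrite entry-penultimate = +<+ z<s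
  entry< a<2+N last          rewrite entry-last        = +<+ a<2+N

  τ-isInversionSequence : a < 2 + N → IsInversionSequence (τ N a)
  τ-isInversionSequence a<2+N i rewrite lookup∘tabulate (entry N a ∘ toℕ) i =
    entry≥0 (position (toℕ<n i)) , entry< a<2+N (position (toℕ<n i))

  lookup-τ-last : lookup (τ N a) (fromℕ (suc N)) ≡ + a
  lookup-τ-last = begin
    lookup (τ N a) (fromℕ (suc N)) ≡⟨ lookup∘tabulate (entry N a ∘ toℕ) (fromℕ (suc N)) ⟩
    entry N a (toℕ (fromℕ (suc N))) ≡⟨ cong (entry N a) (toℕ-fromℕ (suc N)) ⟩
    entry N a (suc N)              ≡⟨ entry-last ⟩
    + a                            ∎
    where open ≡-Reasoning

  -- The condition that `Θ` counts, moved from `Fin` and `lookup` to 0-based natural numbers.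
  Smaller : ℕ → ℕ → Set
  Smaller k j = j < k × entry N a j <ℤ entry N a k

  smaller-initial : ∀ {k} → k < N → ∀ j → Smaller k j ⇔ j < k
  smaller-initial {k} k<N j = mk⇔ proj₁ λ j<k → j<k , lt j<k
    where
    lt : j < k → entry N a j <ℤ entry N a k
    lt j<k rewrite entry-initial k<N | entry-initial (<-trans j<k k<N) = +<+ j<k

  -- The entry is 0 and those before it are nonnegative. The empty set is written as a segment to
  -- fit `count-tabulate-<`.
  smaller-penultimate : ∀ j → Smaller N j ⇔ j < 0
  smaller-penultimate j = mk⇔ absurd λ ()
    where
    absurd : Smaller N j → j < 0
    absurd (j<N , lt) rewrite entry-initial j<N | entry-penultimate =
      drop‿+<+ lt

  -- By a ≤ N each of 0, ..., a-1 occurs among the initial entries, at the index equal to its value;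
  -- by 1 ≤ a the penultimate 0 is also strictly smaller.
  smaller-last : 1 ≤ a → a ≤ N → ∀ j → Smaller (suc N) j ⇔ (j < a ⊎ j ≡ N)
  smaller-last 1≤a a≤N j = mk⇔ fwd bwd
    where
    fwd : Smaller (suc N) j → j < a ⊎ j ≡ N
    fwd (j<1+N , lt) with m≤n⇒m<n∨m≡n (s≤s⁻¹ j<1+N)
    ... | inj₂ j≡N = inj₂ j≡N
    ... | inj₁ j<N rewrite entry-initial j<N | entry-last = inj₁ (drop‿+<+ lt)

    bwd : j < a ⊎ j ≡ N → Smaller (suc N) j
    bwd (inj₁ j<a) rewrite entry-initial (<-≤-trans j<a a≤N) | entry-last =
      m<n⇒m<1+n (<-≤-trans j<a a≤N) , +<+ j<a
    bwd (inj₂ refl) rewrite entry-penultimate | entry-last = ≤-refl , +<+ 1≤a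

module _ (N a : ℕ) where

  -- With `P?` arbitrary, the decision procedure inside `Θ` can be passed unchanged; only the
  -- equivalence is transported along `lookup∘tabulate`.
  count-smaller : 1 ≤ a → a ≤ N → ∀ {k} → Position N k →
    ∀ {p} {P : Pred (Fin (2 + N)) p} (P? : Decidable P) →
    (∀ j → P j ⇔ Smaller N a k (toℕ j)) →
    + count P? (allFin (2 + N)) ≡ entry N (suc a) k
  count-smaller _ _ (initial k<N) P? P⇔ = trans
    (cong +_ (count-tabulate-< P? id (m≤n⇒m≤o+n 2 (<⇒≤ k<N)) λ j →
      smaller-initial N a k<N (toℕ j) ⇔-∘ P⇔ j))
    (sym (entry-initial N (suc a) k<N))
  count-smaller _ _ penultimate P? P⇔ = trans
    (cong +_ (count-tabulate-< P? id z≤n λ j →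
      smaller-penultimate N a (toℕ j) ⇔-∘ P⇔ j))
    (sym (entry-penultimate N (suc a)))
  count-smaller 1≤a a≤N last P? P⇔ = trans
    (cong +_ (count-tabulate-<⊎≡ P? id a≤N (m<n⇒m<1+n ≤-refl) λ j →
      smaller-last N a 1≤a a≤N (toℕ j) ⇔-∘ P⇔ j))
    (sym (entry-last N (suc a)))

  Θ-τ : 1 ≤ a → a ≤ N → Θ (τ N a) ≡ τ N (suc a)
  Θ-τ 1≤a a≤N = tabulate-cong λ i →
    count-smaller 1≤a a≤N (position (toℕ<n i))
      (λ j → (j Fin.<? i) ×-dec (lookup (τ N a) j <ℤ? lookup (τ N a) i))
      (smaller⇔ i)
    where
    smaller⇔ : ∀ i j →
      (j Fin.< i × lookup (τ N a) j <ℤ lookup (τ N a) i) ⇔ Smaller N a (toℕ i) (toℕ j)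
    smaller⇔ i j
      rewrite lookup∘tabulate (entry N a ∘ toℕ) j | lookup∘tabulate (entry N a ∘ toℕ) i
      = ⇔-id _

-- `iterate` applies `Θ` to its argument first, so a varies in the induction. The bound ensures that
-- even the last application starts from a value at most N.
Θ^-τ : ∀ N k {a} → 1 ≤ a → k + a ≤ suc N → Θ^ k (τ N a) ≡ τ N (k + a)
Θ^-τ N zero    _ _ = refl
Θ^-τ N (suc k) {a} 1≤a k+a≤N = begin
  Θ^ k (Θ (τ N a))   ≡⟨ cong (Θ^ k) (Θ-τ N a 1≤a (m+n≤o⇒n≤o k (s≤s⁻¹ k+a≤N))) ⟩
  Θ^ k (τ N (suc a)) ≡⟨ Θ^-τ N k z<s (≤-trans (≤-reflexive (+-suc k a)) k+a≤N) ⟩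
  τ N (k + suc a)    ≡⟨ cong (τ N) (+-suc k a) ⟩
  τ N (suc k + a)    ∎
  where open ≡-Reasoning

τ-injective : ∀ N {a b} → τ N a ≡ τ N b → a ≡ b
τ-injective N {a} {b} eq = +-injective (begin
  + a                            ≡⟨ lookup-τ-last N a ⟨
  lookup (τ N a) (fromℕ (suc N)) ≡⟨ cong (λ σ → lookup σ (fromℕ (suc N))) eq ⟩
  lookup (τ N b) (fromℕ (suc N)) ≡⟨ lookup-τ-last N b ⟩
  + b                            ∎)
  where open ≡-Reasoning

proposition3p7 : (n : ℕ) → 3 ≤ n →
    IsInversionSequence (extremal n)
    × Θ^ (n ∸ 3) (extremal n) ≢ Θ^ (n ∸ 2) (extremal n)
    × ¬ ((σ : Vec ℤ n) → IsInversionSequence σ → FixedByΘ (Θ^ (n ∸ 3) σ))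
proposition3p7 (suc (suc (suc m))) (s≤s (s≤s (s≤s _))) = inversion , changes , sharp
  where
  -- Here n = m + 3, so N = n - 2 and the exponent n - 3 is m.
  N = suc m

  inversion : IsInversionSequence (extremal (2 + N))
  inversion = τ-isInversionSequence N 1 (s<s z<s)

  Θ^m : Θ^ m (τ N 1) ≡ τ N (m + 1)
  Θ^m = Θ^-τ N m ≤-refl (m≤n⇒m≤1+n (≤-reflexive (+-comm m 1)))

  changes : Θ^ m (τ N 1) ≢ Θ^ (suc m) (τ N 1)
  changes eq = 1+n≢n (sym (τ-injective N (begin
    τ N (m + 1)          ≡⟨ Θ^m ⟨
    Θ^ m (τ N 1)         ≡⟨ eq ⟩
    Θ^ (suc m) (τ N 1)   ≡⟨ Θ^-τ N (suc m) ≤-refl (≤-reflexive (cong suc (+-comm m 1))) ⟩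
    τ N (suc (m + 1))    ∎)))
    where open ≡-Reasoning

  -- `Θ^ (suc m)` unfolds to `Θ^ m` after `Θ`, whereas fixedness concerns `Θ` after `Θ^ m`; hence a
  -- separate chain instead of an appeal to `changes`.
  sharp : ¬ ((σ : Vec ℤ (2 + N)) → IsInversionSequence σ → FixedByΘ (Θ^ m σ))
  sharp fixed = 1+n≢n (τ-injective N (begin
    -- The value m + 1 = N is the largest to which `Θ-τ` applies.
    τ N (suc (m + 1))    ≡⟨ Θ-τ N (m + 1) (m≤n+m 1 m) (≤-reflexive (+-comm m 1)) ⟨
    Θ (τ N (m + 1))      ≡⟨ cong Θ Θ^m ⟨
    Θ (Θ^ m (τ N 1))     ≡⟨ fixed (τ N 1) inversion ⟩
    Θ^ m (τ N 1)         ≡⟨ Θ^m ⟩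
    τ N (m + 1)          ∎))
    where open ≡-Reasoning
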